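{- There is no deterministic online algorithm with competitive ratio $o(n)$ for the degree-bounded group Steiner tree problem, where $n$ is the number of vertices. That is, for every deterministic online algorithm $\mathcal{A}$ and every function $f$ with $f(n)=o(n)$, there exist an instance on some number $n$ of vertices and a sequence of demand groups such that the maximum degree of $\mathcal{A}$'s final subgraph exceeds $f(n)\cdot\mathrm{OPT}$.
   Context: Online degree-bounded group Steiner tree: an undirected graph $G$ with a root vertex is given in advance; demands are subsets (groups) of vertices arriving one by one, and after each arrival the online algorithm must add edges (never removing any) so that for every group seen so far, at least one vertex of the group is connected to the root. The objective is to minimize the maximum vertex degree of the final subgraph; $\mathrm{OPT}$ is the minimum maximum degree of a subgraph in which every demand group has a vertex connected to the root. The competitive ratio is the worst-case ratio of the algorithm's maximum degree to $\mathrm{OPT}$. -}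

module Defs where

open import Data.Fin using (Fin)
open import Data.Fin.Subset using (Subset; _∈_; _∉_; _⊆_; ∣_∣; Empty)
open import Data.Integer using (+_)
open import Data.List using (List; []; _∷_; tabulate)
open import Data.List.Extrema.Nat using (max)
open import Data.List.Relation.Unary.All using (All)
open import Data.Nat as ℕ using (ℕ)
open import Data.Product using (∃; _×_)
open import Data.Rational as ℚ using (ℚ; 0ℚ; _/_)
open import Relation.Binary.Construct.Closure.ReflexiveTransitive using (Star)
open import Relation.Binary.PropositionalEquality using (_≡_)

-- Finite simple undirected graphs on the vertex set Fin n.
record Graph (n : ℕ) : Set where
  field
    neighbours : Fin n → Subset n
    symmetric  : ∀ {u v} → v ∈ neighbours u → u ∈ neighbours v
    loopless   : ∀ {v} → v ∉ neighbours v

open Graph public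

degree : ∀ {n} → Graph n → Fin n → ℕ
degree G v = ∣ neighbours G v ∣

maxDegree : ∀ {n} → Graph n → ℕ
maxDegree G = max 0 (tabulate (degree G))

-- Subgraphs are taken to be spanning (isolated vertices change neither degrees
-- nor connections to the root), so a subgraph is just a set of edges.
_⊑_ : ∀ {n} → Graph n → Graph n → Set
H ⊑ G = ∀ v → neighbours H v ⊆ neighbours G v

Edgeless : ∀ {n} → Graph n → Set
Edgeless H = ∀ v → Empty (neighbours H v)

Connected : ∀ {n} → Graph n → Fin n → Fin n → Set
Connected G = Star (λ u v → v ∈ neighbours G u)

record RootedGraph (n : ℕ) : Set where
  field
    graph : Graph n
    root  : Fin n

open RootedGraph public

-- A sequence of demand groups, the most recently arrived group first.
Demands : ℕ → Set
Demands n = List (Subset n)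

Serves : ∀ {n} → Graph n → Fin n → Demands n → Set
Serves H r = All (λ g → ∃ λ v → v ∈ g × Connected H r v)

IsSolution : ∀ {n} → RootedGraph n → Demands n → Graph n → Set
IsSolution I gs H = H ⊑ graph I × Serves H (root I) gs

-- Demands that can be met at all, i.e. by buying every edge.
Feasible : ∀ {n} → RootedGraph n → Demands n → Set
Feasible I gs = Serves (graph I) (root I) gs

record IsOPT {n : ℕ} (I : RootedGraph n) (gs : Demands n) (opt : ℕ) : Set where
  field
    attained : ∃ λ H → IsSolution I gs H × maxDegree H ≡ opt
    minimal  : ∀ H → IsSolution I gs H → opt ℕ.≤ maxDegree H

-- A deterministic online algorithm: its current subgraph is a function of the
-- rooted graph (known in advance) and the groups that have arrived so far.
-- Nothing is asked of it on demand sequences that no subgraph can serve.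
record OnlineAlgorithm : Set where
  field
    output   : ∀ {n} → RootedGraph n → Demands n → Graph n
    start    : ∀ {n} (I : RootedGraph n) → Edgeless (output I [])
    monotone : ∀ {n} (I : RootedGraph n) g gs → Feasible I (g ∷ gs) →
               output I gs ⊑ output I (g ∷ gs)
    correct  : ∀ {n} (I : RootedGraph n) gs → Feasible I gs →
               IsSolution I gs (output I gs)

open OnlineAlgorithm public

fromℕ : ℕ → ℚ
fromℕ k = + k / 1

-- f(n) = o(n)
Sublinear : (ℕ → ℚ) → Set
Sublinear f = ∀ ε → 0ℚ ℚ.< ε →
  ∃ λ N → ∀ n → N ℕ.≤ n → ℚ.∣ f n ∣ ℚ.≤ ε ℚ.* fromℕ n

{-# OPTIONS --safe #-}

-- Suppose that all neighbours of the root are leaves.  The adversary keeps demanding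
-- the group of those neighbours not yet joined to the root, and each demand forces a
-- new edge at the root, until all of them are bought.  The demanded groups are nested,
-- so a single edge to a vertex of the last one serves them all and OPT = 1.  On the
-- star with n vertices the algorithm thus reaches degree n - 1.
module Submission where

open import Data.Fin using (Fin; zero; suc; _≟_)
open import Data.Fin.Subset
  using (Subset; _∈_; _∉_; _⊆_; _⊂_; _⊃_; Nonempty; Empty; inside; outside; ∁; ⁅_⁆; _─_; ∣_∣)
open import Data.Fin.Subset.Induction using (Acc; acc; ⊃-wellFounded)
open import Data.Fin.Subset.Properties
  using (x∈⁅x⁆; x∈⁅y⁆⇔x≡y; x≢y⇒x∉⁅y⁆; ∣⁅x⁆∣≡1; ∣∁p∣≡n∸∣p∣; _∈?_; nonempty?; x∈p⇒∣p-x∣<∣p∣;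
    p⊆q⇒∣p∣≤∣q∣; p─q⊆p; x∈p∧x∉q⇒x∈p─q; x∈∁p⇒x∉p; x∉p⇒x∈∁p; ⊆-trans; ⊆-antisym)
open import Data.Integer as ℤ using (+_; +<+; +≤+)
import Data.Integer.Properties as ℤ
open import Data.List using ([]; _∷_)
open import Data.List.Extrema.Nat using (max≤v⁺; xs≤max)
open import Data.List.Relation.Unary.All as All using (All; []; _∷_)
import Data.List.Relation.Unary.All.Properties as All
open import Data.List.Relation.Unary.Any using (Any; here)
open import Data.Nat as ℕ using (ℕ; suc; z≤n; s≤s)
import Data.Nat.Properties as ℕ
open import Data.Product using (Σ-syntax; ∃; _×_; _,_)
open import Data.Rational as ℚ using (ℚ; _*_; _<_; _≤_; 0ℚ; ½; toℚᵘ; fromℚᵘ)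
import Data.Rational.Properties as ℚ
open import Data.Rational.Unnormalised as ℚᵘ using (mkℚᵘ; *<*; *≤*)
import Data.Rational.Unnormalised.Properties as ℚᵘ
open import Data.Sum using (_⊎_; inj₁; inj₂; swap)
open import Data.Vec using (tabulate; _∷_; there)
open import Data.Vec.Properties using ([]=⇒lookup; lookup⇒[]=; lookup∘tabulate)
open import Function using (_∘_; Equivalence)
open import Level using (Level; 0ℓ)
open import Relation.Binary.Construct.Closure.ReflexiveTransitive as Star using (ε; _◅_)
open import Relation.Binary.Core using (Rel)
open import Relation.Binary.Definitions as Binary using (Symmetric; Irreflexive)
open import Relation.Binary.PropositionalEquality
  using (_≡_; _≢_; refl; sym; trans; cong; subst; subst₂; ≢-sym; module ≡-Reasoning)
import Relation.Binary.Reasoning.Setoid as ≈-Reasoning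
open import Relation.Nullary using (yes; no; does; contradiction)
open import Relation.Nullary.Decidable using (_×-dec_; _⊎-dec_; ¬?; dec-true; decidable-stable)
open import Relation.Unary using (Pred; Decidable)
open import Defs

private variable
  ℓ : Level
  n : ℕ

x∈p─q⇒x∉q : ∀ {x} (p q : Subset n) → x ∈ p ─ q → x ∉ q
x∈p─q⇒x∉q (_ ∷ p) (outside ∷ q) (there x∈p─q) (there x∈q) = x∈p─q⇒x∉q p q x∈p─q x∈q
x∈p─q⇒x∉q (_ ∷ p) (inside  ∷ q) (there x∈p─q) (there x∈q) = x∈p─q⇒x∉q p q x∈p─q x∈q

q⊆r⇒p─r⊆p─q : ∀ (p q r : Subset n) → q ⊆ r → p ─ r ⊆ p ─ q
q⊆r⇒p─r⊆p─q p q r q⊆r x∈p─r =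
  x∈p∧x∉q⇒x∈p─q (p─q⊆p p r x∈p─r) (x∈p─q⇒x∉q p r x∈p─r ∘ q⊆r)

Empty[p─q]⇒p⊆q : ∀ (p q : Subset n) → Empty (p ─ q) → p ⊆ q
Empty[p─q]⇒p⊆q p q empty {x} x∈p =
  decidable-stable (x ∈? q) (λ x∉q → empty (x , x∈p∧x∉q⇒x∈p─q x∈p x∉q))

Nonempty⇒1≤∣p∣ : ∀ {p : Subset n} → Nonempty p → 1 ℕ.≤ ∣ p ∣
Nonempty⇒1≤∣p∣ (_ , x∈p) = ℕ.≤-<-trans z≤n (x∈p⇒∣p-x∣<∣p∣ x∈p)

module _ {P : Pred (Fin n) ℓ} (P? : Decidable P) where

  comprehension : Subset n
  comprehension = tabulate (does ∘ P?)

  ∈-comprehension⁺ : ∀ {x} → P x → x ∈ comprehension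
  ∈-comprehension⁺ {x} px =
    lookup⇒[]= x _ (trans (lookup∘tabulate (does ∘ P?) x) (dec-true (P? x) px))

  ∈-comprehension⁻ : ∀ {x} → x ∈ comprehension → P x
  ∈-comprehension⁻ {x} x∈
    with P? x | trans (sym (lookup∘tabulate (does ∘ P?) x)) ([]=⇒lookup x∈)
  ... | yes px | _ = px

  ∣comprehension∣≤1 : ∀ x → (∀ {y} → P y → y ≡ x) → ∣ comprehension ∣ ℕ.≤ 1
  ∣comprehension∣≤1 x only-x = begin
    ∣ comprehension ∣  ≤⟨ p⊆q⇒∣p∣≤∣q∣ (Equivalence.from x∈⁅y⁆⇔x≡y ∘ only-x ∘ ∈-comprehension⁻) ⟩
    ∣ ⁅ x ⁆ ∣          ≡⟨ ∣⁅x⁆∣≡1 x ⟩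
    1                  ∎
    where open ℕ.≤-Reasoning

fromRelation : {_∼_ : Rel (Fin n) ℓ} → Binary.Decidable _∼_ →
  Symmetric _∼_ → Irreflexive _≡_ _∼_ → Graph n
fromRelation _∼?_ ∼-sym ∼-irrefl = record
  { neighbours = λ u → comprehension (u ∼?_)
  ; symmetric  = λ {u} {v} → ∈-comprehension⁺ (v ∼?_) ∘ ∼-sym ∘ ∈-comprehension⁻ (u ∼?_)
  ; loopless   = λ {v} → ∼-irrefl refl ∘ ∈-comprehension⁻ (v ∼?_)
  }

adjacent⇒≢ : ∀ (G : Graph n) {u v} → v ∈ neighbours G u → u ≢ v
adjacent⇒≢ G v∈Nu refl = loopless G v∈Nu

degree≤maxDegree : ∀ (G : Graph n) v → degree G v ℕ.≤ maxDegree G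
degree≤maxDegree G = All.tabulate⁻ (xs≤max 0 _)

maxDegree-lub : ∀ {k} (G : Graph n) → (∀ v → degree G v ℕ.≤ k) → maxDegree G ℕ.≤ k
maxDegree-lub G degree≤k = max≤v⁺ z≤n (All.tabulate⁺ degree≤k)

connected⇒Nonempty-neighbours : ∀ (G : Graph n) {u v} → u ≢ v → Connected G u v →
  Nonempty (neighbours G u)
connected⇒Nonempty-neighbours G u≢u ε       = contradiction refl u≢u
connected⇒Nonempty-neighbours G _   (e ◅ _) = _ , e

neighbour-serves : ∀ (G : Graph n) {r v gs} → v ∈ neighbours G r → All (v ∈_) gs →
  Serves G r gs
neighbour-serves G v∈Nr = All.map (λ v∈g → _ , v∈g , v∈Nr ◅ ε)

serves⇒1≤maxDegree : ∀ (G : Graph n) {r gs} → Any (r ∉_) gs → Serves G r gs →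
  1 ℕ.≤ maxDegree G
serves⇒1≤maxDegree G {r} r∉some serves with All.lookupAny serves r∉some
... | (v , v∈g , path) , r∉g = ℕ.≤-trans
  (Nonempty⇒1≤∣p∣ (connected⇒Nonempty-neighbours G r≢v path)) (degree≤maxDegree G r)
  where
  r≢v : r ≢ v
  r≢v refl = r∉g v∈g

module _ (u v : Fin n) where

  Joins : Rel (Fin n) 0ℓ
  Joins x y = (x ≡ u × y ≡ v) ⊎ (x ≡ v × y ≡ u)

  joins? : Binary.Decidable Joins
  joins? x y = (x ≟ u ×-dec y ≟ v) ⊎-dec (x ≟ v ×-dec y ≟ u)

module _ {u v : Fin n} (u≢v : u ≢ v) where

  Joins-functional : ∀ x → ∃ λ w → ∀ {y} → Joins u v x y → y ≡ w
  Joins-functional x with x ≟ u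
  ... | yes refl = v , λ { (inj₁ (_ , y≡v)) → y≡v ; (inj₂ (u≡v , _)) → contradiction u≡v u≢v }
  ... | no  x≢u  = u , λ { (inj₁ (x≡u , _)) → contradiction x≡u x≢u ; (inj₂ (_ , y≡u)) → y≡u }

  edge : Graph n
  edge = fromRelation (joins? u v)
    (λ { (inj₁ (x≡u , y≡v)) → inj₂ (y≡v , x≡u)
       ; (inj₂ (x≡v , y≡u)) → inj₁ (y≡u , x≡v) })
    (λ { refl (inj₁ (x≡u , x≡v)) → u≢v (trans (sym x≡u) x≡v)
       ; refl (inj₂ (x≡v , x≡u)) → u≢v (trans (sym x≡u) x≡v) })

  ∈-neighbours-edge : v ∈ neighbours edge u
  ∈-neighbours-edge = ∈-comprehension⁺ (joins? u v u) (inj₁ (refl , refl))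

  edge-⊑ : ∀ (G : Graph n) → v ∈ neighbours G u → edge ⊑ G
  edge-⊑ G v∈Nu x y∈Nx with ∈-comprehension⁻ (joins? u v x) y∈Nx
  ... | inj₁ (refl , refl) = v∈Nu
  ... | inj₂ (refl , refl) = symmetric G v∈Nu

  maxDegree-edge≤1 : maxDegree edge ℕ.≤ 1
  maxDegree-edge≤1 = maxDegree-lub edge λ x →
    let w , only-w = Joins-functional x in ∣comprehension∣≤1 (joins? u v x) w only-w

common-neighbour⇒isOPT-1 : ∀ (I : RootedGraph n) {v gs} → v ∈ neighbours (graph I) (root I) →
  All (v ∈_) gs → Any (root I ∉_) gs → IsOPT I gs 1
common-neighbour⇒isOPT-1 I {v} {gs} v∈Nr v∈gs r∉some = record
  { attained = edge r≢v , edge-solves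
             , ℕ.≤-antisym (maxDegree-edge≤1 r≢v) (minimal (edge r≢v) edge-solves)
  ; minimal  = minimal
  }
  where
  r≢v : root I ≢ v
  r≢v = adjacent⇒≢ (graph I) v∈Nr

  edge-solves : IsSolution I gs (edge r≢v)
  edge-solves =
    edge-⊑ r≢v (graph I) v∈Nr , neighbour-serves (edge r≢v) (∈-neighbours-edge r≢v) v∈gs

  minimal : ∀ H → IsSolution I gs H → 1 ℕ.≤ maxDegree H
  minimal H (_ , serves) = serves⇒1≤maxDegree H r∉some serves

RootNeighboursAreLeaves : RootedGraph n → Set
RootNeighboursAreLeaves I = ∀ {v w} →
  v ∈ neighbours (graph I) (root I) → w ∈ neighbours (graph I) v → w ≡ root I

-- Reversing the path makes it start with an edge at v, and v is a leaf.
connected-leaf⇒adjacent : ∀ (I : RootedGraph n) → RootNeighboursAreLeaves I →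
  ∀ H {v} → H ⊑ graph I → v ∈ neighbours (graph I) (root I) → Connected H (root I) v →
  v ∈ neighbours H (root I)
connected-leaf⇒adjacent I leaves H {v} H⊑G v∈Nr path =
  let w , w∈Nv = connected⇒Nonempty-neighbours H (≢-sym (adjacent⇒≢ (graph I) v∈Nr))
                   (Star.reverse (symmetric H) path)
  in symmetric H (subst (_∈ neighbours H v) (leaves v∈Nr (H⊑G v w∈Nv)) w∈Nv)

module Adversary (A : OnlineAlgorithm) (I : RootedGraph n) (leaves : RootNeighboursAreLeaves I)
  where

  private
    G : Graph n
    G = graph I

    r : Fin n
    r = root I

  bought unbought : Demands n → Subset n
  bought   gs = neighbours (output A I gs) r
  unbought gs = neighbours G r ─ bought gs

  unbought⊆neighbours : ∀ gs → unbought gs ⊆ neighbours G r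
  unbought⊆neighbours gs = p─q⊆p (neighbours G r) (bought gs)

  extend : Demands n → Demands n
  extend gs = unbought gs ∷ gs

  Nested : Demands n → Set
  Nested gs = All (unbought gs ⊆_) gs

  module _ {gs v} (nested : Nested gs) (v∈unbought : v ∈ unbought gs) where

    ∈-extend : All (v ∈_) (extend gs)
    ∈-extend = v∈unbought ∷ All.map (λ unbought⊆g → unbought⊆g v∈unbought) nested

    extend-feasible : Feasible I (extend gs)
    extend-feasible = neighbour-serves G (unbought⊆neighbours gs v∈unbought) ∈-extend

    extend-isOPT-1 : IsOPT I (extend gs) 1
    extend-isOPT-1 = common-neighbour⇒isOPT-1 I (unbought⊆neighbours gs v∈unbought) ∈-extend
      (here (loopless G ∘ unbought⊆neighbours gs))

    extend-bought-⊆ : bought gs ⊆ bought (extend gs)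
    extend-bought-⊆ = monotone A I (unbought gs) gs extend-feasible r

    extend-bought-⊂ : bought gs ⊂ bought (extend gs)
    extend-bought-⊂ with correct A I (extend gs) extend-feasible
    ... | H⊑G , (w , w∈unbought , path) ∷ _ =
      extend-bought-⊆ , w
      , connected-leaf⇒adjacent I leaves (output A I (extend gs)) H⊑G
          (unbought⊆neighbours gs w∈unbought) path
      , x∈p─q⇒x∉q (neighbours G r) (bought gs) w∈unbought

    extend-nested : Nested (extend gs)
    extend-nested = extend-unbought-⊆ ∷ All.map (⊆-trans extend-unbought-⊆) nested
      where
      extend-unbought-⊆ : unbought (extend gs) ⊆ unbought gs
      extend-unbought-⊆ =
        q⊆r⇒p─r⊆p─q (neighbours G r) (bought gs) (bought (extend gs)) extend-bought-⊆

  exhaust : ∀ {gs v} → Acc _⊃_ (bought gs) → Nested gs → v ∈ unbought gs →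
    ∃ λ gs′ → Feasible I gs′ × IsOPT I gs′ 1 × Empty (unbought gs′)
  exhaust {gs} (acc rec) nested v∈unbought with nonempty? (unbought (extend gs))
  ... | yes (_ , w∈unbought) =
    exhaust (rec (extend-bought-⊂ nested v∈unbought)) (extend-nested nested v∈unbought) w∈unbought
  ... | no empty =
    extend gs , extend-feasible nested v∈unbought , extend-isOPT-1 nested v∈unbought , empty

  root-degree-forced : Nonempty (neighbours G r) →
    ∃ λ gs → Feasible I gs × IsOPT I gs 1 × degree G r ℕ.≤ maxDegree (output A I gs)
  root-degree-forced (v , v∈Nr) =
    let gs , feasible , isOPT , empty = exhaust (⊃-wellFounded (bought [])) [] v∈unbought
    in gs , feasible , isOPT , ℕ.≤-trans
         (p⊆q⇒∣p∣≤∣q∣ (Empty[p─q]⇒p⊆q (neighbours G r) (bought gs) empty))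
         (degree≤maxDegree (output A I gs) r)
    where
    v∈unbought : v ∈ unbought []
    v∈unbought = x∈p∧x∉q⇒x∈p─q v∈Nr (λ v∈bought → start A I r (v , v∈bought))

module _ (c : Fin n) where

  Spoke : Rel (Fin n) 0ℓ
  Spoke u v = (u ≡ c ⊎ v ≡ c) × u ≢ v

  spoke? : Binary.Decidable Spoke
  spoke? u v = (u ≟ c ⊎-dec v ≟ c) ×-dec ¬? (u ≟ v)

  star : RootedGraph n
  star = record
    { graph = fromRelation spoke? (λ (c∈uv , u≢v) → swap c∈uv , ≢-sym u≢v)
                                  (λ u≡v (_ , u≢v) → u≢v u≡v)
    ; root  = c
    }

  ∈-neighbours-star-centre : ∀ {v} → c ≢ v → v ∈ neighbours (graph star) c
  ∈-neighbours-star-centre c≢v = ∈-comprehension⁺ (spoke? c) (inj₁ refl , c≢v)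

  neighbours-star-centre : neighbours (graph star) c ≡ ∁ ⁅ c ⁆
  neighbours-star-centre = ⊆-antisym
    (x∉p⇒x∈∁p ∘ x≢y⇒x∉⁅y⁆ ∘ ≢-sym ∘ adjacent⇒≢ (graph star))
    (λ v∈∁c → ∈-neighbours-star-centre λ { refl → x∈∁p⇒x∉p v∈∁c (x∈⁅x⁆ c) })

  degree-star-centre : degree (graph star) c ≡ n ℕ.∸ 1
  degree-star-centre = begin
    degree (graph star) c  ≡⟨ cong ∣_∣ neighbours-star-centre ⟩
    ∣ ∁ ⁅ c ⁆ ∣            ≡⟨ ∣∁p∣≡n∸∣p∣ ⁅ c ⁆ ⟩
    n ℕ.∸ ∣ ⁅ c ⁆ ∣        ≡⟨ cong (n ℕ.∸_) (∣⁅x⁆∣≡1 c) ⟩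
    n ℕ.∸ 1                ∎
    where open ≡-Reasoning

  star-rootNeighboursAreLeaves : RootNeighboursAreLeaves star
  star-rootNeighboursAreLeaves {v} v∈Nc w∈Nv with ∈-comprehension⁻ (spoke? v) w∈Nv
  ... | inj₁ v≡c , _ = contradiction (sym v≡c) (adjacent⇒≢ (graph star) v∈Nc)
  ... | inj₂ w≡c , _ = w≡c

  star-forces-degree : ∀ (A : OnlineAlgorithm) {v} → c ≢ v →
    ∃ λ gs → Feasible star gs × IsOPT star gs 1 × n ℕ.∸ 1 ℕ.≤ maxDegree (output A star gs)
  star-forces-degree A c≢v =
    let gs , feasible , isOPT , degree≤ =
          Adversary.root-degree-forced A star star-rootNeighboursAreLeaves
            (_ , ∈-neighbours-star-centre c≢v)
    in gs , feasible , isOPT , ℕ.≤-trans (ℕ.≤-reflexive (sym degree-star-centre)) degree≤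

3≤n⇒n<[n∸1]*2 : ∀ {n} → 3 ℕ.≤ n → n ℕ.< (n ℕ.∸ 1) ℕ.* 2
3≤n⇒n<[n∸1]*2 {suc m} (s≤s 2≤m) = begin-strict
  suc m      <⟨ ℕ.+-monoˡ-≤ m 2≤m ⟩
  m ℕ.+ m    ≡⟨ cong (m ℕ.+_) (ℕ.+-identityʳ m) ⟨
  2 ℕ.* m    ≡⟨ ℕ.*-comm 2 m ⟩
  m ℕ.* 2    ∎
  where open ℕ.≤-Reasoning

p≤∣p∣ : ∀ p → p ≤ ℚ.∣ p ∣
p≤∣p∣ p with ℚ.≤-total 0ℚ p
... | inj₁ 0≤p = ℚ.≤-reflexive (sym (ℚ.0≤p⇒∣p∣≡p 0≤p))
... | inj₂ p≤0 = ℚ.≤-trans p≤0 (ℚ.0≤∣p∣ p)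

fromℚᵘ-mono-< : ∀ p q → p ℚᵘ.< q → fromℚᵘ p < fromℚᵘ q
fromℚᵘ-mono-< p q p<q = ℚ.toℚᵘ-cancel-< (begin-strict
  toℚᵘ (fromℚᵘ p)  ≃⟨ ℚ.toℚᵘ-fromℚᵘ p ⟩
  p                <⟨ p<q ⟩
  q                ≃⟨ ℚ.toℚᵘ-fromℚᵘ q ⟨
  toℚᵘ (fromℚᵘ q)  ∎)
  where open ℚᵘ.≤-Reasoning

fromℚᵘ-mono-≤ : ∀ p q → p ℚᵘ.≤ q → fromℚᵘ p ≤ fromℚᵘ q
fromℚᵘ-mono-≤ p q p≤q = ℚ.toℚᵘ-cancel-≤ (begin
  toℚᵘ (fromℚᵘ p)  ≃⟨ ℚ.toℚᵘ-fromℚᵘ p ⟩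
  p                ≤⟨ p≤q ⟩
  q                ≃⟨ ℚ.toℚᵘ-fromℚᵘ q ⟨
  toℚᵘ (fromℚᵘ q)  ∎)
  where open ℚᵘ.≤-Reasoning

fromℚᵘ-homo-* : ∀ p q → fromℚᵘ (p ℚᵘ.* q) ≡ fromℚᵘ p * fromℚᵘ q
fromℚᵘ-homo-* p q = ℚ.toℚᵘ-injective (begin
  toℚᵘ (fromℚᵘ (p ℚᵘ.* q))              ≈⟨ ℚ.toℚᵘ-fromℚᵘ (p ℚᵘ.* q) ⟩
  p ℚᵘ.* q                              ≈⟨ ℚᵘ.*-cong (ℚ.toℚᵘ-fromℚᵘ p) (ℚ.toℚᵘ-fromℚᵘ q) ⟨
  toℚᵘ (fromℚᵘ p) ℚᵘ.* toℚᵘ (fromℚᵘ q)  ≈⟨ ℚ.toℚᵘ-homo-* (fromℚᵘ p) (fromℚᵘ q) ⟨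
  toℚᵘ (fromℚᵘ p * fromℚᵘ q)            ∎)
  where open ≈-Reasoning ℚᵘ.≃-setoid

fromℕ-mono-≤ : ∀ j k → j ℕ.≤ k → fromℕ j ≤ fromℕ k
fromℕ-mono-≤ j k j≤k = fromℚᵘ-mono-≤ (mkℚᵘ (+ j) 0) (mkℚᵘ (+ k) 0)
  (*≤* (ℤ.*-monoʳ-≤-nonNeg (+ 1) (+≤+ j≤k)))

½*fromℕ-< : ∀ j k → j ℕ.< k ℕ.* 2 → ½ * fromℕ j < fromℕ k
½*fromℕ-< j k j<2k = begin-strict
  ½ * fromℕ j                      ≡⟨ fromℚᵘ-homo-* ℚᵘ.½ (mkℚᵘ (+ j) 0) ⟨
  fromℚᵘ (ℚᵘ.½ ℚᵘ.* mkℚᵘ (+ j) 0)  <⟨ fromℚᵘ-mono-< (ℚᵘ.½ ℚᵘ.* mkℚᵘ (+ j) 0) (mkℚᵘ (+ k) 0)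
                                        (*<* cross-multiplied) ⟩
  fromℕ k                          ∎
  where
  open ℚ.≤-Reasoning
  cross-multiplied : (+ 1 ℤ.* + j) ℤ.* + 1 ℤ.< + k ℤ.* + 2
  cross-multiplied = subst₂ ℤ._<_ (sym (trans (ℤ.*-identityʳ _) (ℤ.*-identityˡ (+ j))))
                       (ℤ.pos-* k 2) (+<+ j<2k)

sublinear⇒eventually-<n∸1 : ∀ f → Sublinear f →
  ∃ λ N → ∀ n → N ℕ.≤ n → f n < fromℕ (n ℕ.∸ 1)
sublinear⇒eventually-<n∸1 f sublinear =
  let N , ∣f∣≤½n = sublinear ½ (ℚ.positive⁻¹ ½)
  in 3 ℕ.+ N , λ n 3+N≤n → begin-strict
    f n              ≤⟨ p≤∣p∣ (f n) ⟩
    ℚ.∣ f n ∣        ≤⟨ ∣f∣≤½n n (ℕ.m+n≤o⇒n≤o 3 3+N≤n) ⟩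
    ½ * fromℕ n      <⟨ ½*fromℕ-< n (n ℕ.∸ 1) (3≤n⇒n<[n∸1]*2 (ℕ.m+n≤o⇒m≤o 3 3+N≤n)) ⟩
    fromℕ (n ℕ.∸ 1)  ∎
  where open ℚ.≤-Reasoning

star-defeats : ∀ (A : OnlineAlgorithm) {c v : Fin n} → c ≢ v → ∀ q → q < fromℕ (n ℕ.∸ 1) →
  Σ[ gs ∈ Demands n ] Σ[ opt ∈ ℕ ]
    Feasible (star c) gs × IsOPT (star c) gs opt ×
    q * fromℕ opt < fromℕ (maxDegree (output A (star c) gs))
star-defeats {n} A {c} c≢v q q<n∸1 =
  let gs , feasible , isOPT , n∸1≤d = star-forces-degree c A c≢v
      d                             = maxDegree (output A (star c) gs)
  in gs , 1 , feasible , isOPT , (begin-strict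
    q * fromℕ 1      ≡⟨ ℚ.*-identityʳ q ⟩
    q                <⟨ q<n∸1 ⟩
    fromℕ (n ℕ.∸ 1)  ≤⟨ fromℕ-mono-≤ (n ℕ.∸ 1) d n∸1≤d ⟩
    fromℕ d          ∎)
  where open ℚ.≤-Reasoning

theorem4 : (A : OnlineAlgorithm) (f : ℕ → ℚ) → Sublinear f →
  Σ[ n ∈ ℕ ] Σ[ I ∈ RootedGraph n ] Σ[ gs ∈ Demands n ] Σ[ opt ∈ ℕ ]
    Feasible I gs × IsOPT I gs opt ×
    f n * fromℕ opt < fromℕ (maxDegree (output A I gs))
theorem4 A f sublinear =
  let N , f<n∸1 = sublinear⇒eventually-<n∸1 f sublinear
      n         = 2 ℕ.+ N
  in n , star zero , star-defeats {n} A {zero} {suc zero} (λ ()) (f n) (f<n∸1 n (ℕ.m≤n+m N 2))
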